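{- Let $v\ge 4$ be an integer with $v\not\equiv 2\pmod 4$. Then there exists an AOA$(1,3,5,v)$.
   Context: An orthogonal array OA$(t,k,v)$ is a $v^t\times k$ array with entries from a set $X$ of size $v$ such that the restriction to any $t$ columns contains every $t$-tuple of $X^t$ exactly once. An AOA$(s,t,k,v)$ is a $v^t\times (k+1)$ array $A$ such that: (1) the first $k$ columns form an OA$(t,k,v)$ on a set $X$ with $|X|=v$; (2) the last column has symbols from a set $Y$ with $|Y|=v^{t-s}$; (3) any $s$ of the first $k$ columns together with the last column contain every $(s+1)$-tuple of $X^s\times Y$ exactly once. -}

module Defs where

open import Data.Nat using (ℕ; _^_; _∸_)
open import Data.Fin using (Fin)
open import Data.Product using (Σ; _×_; _,_)
open import Relation.Binary.PropositionalEquality using (_≡_)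
open import Function.Definitions using (Injective)

ExactlyOne : ∀ {n} → (Fin n → Set) → Set
ExactlyOne {n} P = Σ (Fin n) λ r → P r × (∀ r′ → P r′ → r′ ≡ r)

Columns : ℕ → ℕ → Set
Columns t k = Σ (Fin t → Fin k) λ c → Injective _≡_ _≡_ c

Array : ℕ → ℕ → ℕ → Set
Array t k v = Fin (v ^ t) → Fin k → Fin v

IsOA : (t k v : ℕ) → Array t k v → Set
IsOA t k v A =
  ((c , _) : Columns t k) → (x : Fin t → Fin v) →
  ExactlyOne (λ r → ∀ i → A r (c i) ≡ x i)

-- AOA(s,t,k,v): a v^t × (k+1) array, given as the first k columns A
-- (over X = Fin v) together with the last column L (over Y = Fin (v^(t-s))).
record AOA (s t k v : ℕ) : Set where
  field
    A     : Array t k v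
    L     : Fin (v ^ t) → Fin (v ^ (t ∸ s))
    isOA  : IsOA t k v A
    augm  : ((c , _) : Columns s k) → (x : Fin s → Fin v) →
            (y : Fin (v ^ (t ∸ s))) →
            ExactlyOne (λ r → (∀ i → A r (c i) ≡ x i) × L r ≡ y)

{-# OPTIONS --safe #-}
-- The array is built from a difference matrix: rows 0, x, y, z indexed by the elements of an abelian
-- group G of order v such that every difference of two rows is a bijection. The five columns
-- a, a + x, b, b + z − y, a + b + z of the array with rows (a , b , j) ∈ G³ form an OA(3,5,v), because
-- any three of them determine some difference of two rows of the matrix at j. The same holds for the
-- last column (a + z , b − y) together with any one of the five.
--
-- Difference matrices multiply, and an endomorphism α with α, α − 1 and α + 1 injective yields
-- one with rows 0, 1, α, 1 + α. This covers orders prime to 6 (α = 2), squares (α² = α + 1) and cubes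
-- (α³ = α + 1). What remains is a single factor 3: orders 12 and 24, and 3m with m prime to 6. There,
-- ℤ/3-components are attached to a threefold copy of the matrix with rows 0, 1, α, 1 + α in which one row
-- has been shifted differently in each copy. For 3m (and α = 2) the ℤ/3-components at t ∈ ℤ/m are
-- read off a cyclic word of length m, and columns that could clash are at most 4 steps apart,
-- so that correctness is a finite condition on the short factors of the word.
module Submission where

open import Defs
open import Level using (0ℓ)
open import Algebra.Bundles using (AbelianGroup)
import Algebra.Construct.DirectProduct as DirectProduct
import Algebra.Properties.AbelianGroup as AbelianGroupProperties
import Algebra.Solver.CommutativeMonoid as CommutativeMonoidSolver
open import Data.Fin
  using (Fin; zero; suc; toℕ; fromℕ<; combine; remQuot; finToFun; funToFin; punchOut)
open import Data.Fin.Patterns using (0F; 1F; 2F; 3F; 4F; 5F; 6F; 7F; 8F; 9F)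
open import Data.Fin.Properties
  using (_≟_; any?; all?; injective⇒≤; punchOut-injective; combine-injective; combine-remQuot;
         funToFin-finToFin; finToFun-funToFin; toℕ<n; toℕ-injective; toℕ-fromℕ; toℕ-inject₁;
         fromℕ<-injective)
open import Data.Fin.Relation.Unary.Top using (view; ‵fromℕ; ‵inject₁)
open import Data.Integer as ℤ using (ℤ; +_; -[1+_]; 0ℤ)
open import Data.Integer.DivMod using (_%ℕ_; _/ℕ_; n%ℕd<d; a≡a%ℕn+[a/ℕn]*n)
open import Data.Integer.Divisibility.Signed
  using (_∣_; divides; _∣?_; ∣ᵤ⇒∣; ∣⇒∣ᵤ; ∣m⇒∣-m; ∣m∣n⇒∣m+n; ∣m∣n⇒∣m-n)
import Data.Integer.Properties as ℤ
open import Data.Integer.Tactic.RingSolver using (solve-∀)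
open import Data.List using (List; []; _∷_; concatMap)
open import Data.List.Membership.Propositional using (_∈_)
open import Data.List.Membership.Propositional.Properties using (∈-concatMap⁺)
import Data.List.Membership.DecPropositional as DecMembership
open import Data.List.Relation.Unary.All as All using (All; []; _∷_)
open import Data.List.Relation.Unary.Any as Any using (Any; here; there)
open import Data.Nat as ℕ
  using (ℕ; suc; _+_; _*_; _^_; _%_; _≤_; _<_; s≤s; z≤n; NonZero; NonTrivial;
         ≢-nonZero; >-nonZero; nonTrivial⇒n>1)
open import Data.Nat.Coprimality using (Coprime; coprime-divisor; 1-coprimeTo)
  renaming (sym to coprime-sym)
open import Data.Nat.DivMod using (_divMod_; result; m%n<n; m<n⇒m%n≡m; m%n*o≡m*o%[n*o])
import Data.Nat.Divisibility as ℕ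
open import Data.Nat.Induction using (<-rec)
open import Data.Nat.Primality using (Prime; prime[2]; prime?; prime⇒irreducible)
import Data.Nat.Properties as ℕ
import Data.Nat.Tactic.RingSolver as ℕ-RingSolver
open import Data.Product using (_×_; _,_; proj₁; proj₂; uncurry; ∃₂)
open import Data.Product.Relation.Binary.Pointwise.NonDependent using (×-decidable)
open import Data.Sum using (inj₁; inj₂)
open import Data.Unit using (⊤; tt)
open import Data.Vec using (Vec; []; _∷_; lookup)
open import Function using (_∘_)
open import Function.Definitions using (Injective)
open import Relation.Binary using (Decidable)
open import Relation.Binary.PropositionalEquality
  using (_≡_; _≢_; refl; sym; trans; cong; cong₂; subst; subst₂; module ≡-Reasoning)
open import Relation.Nullary using (Dec; yes; no; contradiction)
open import Relation.Nullary.Decidable using (from-yes; ¬?; _→-dec_; _×-dec_)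

-- Pigeonhole and encodings of finite tuples.

private variable
  m n : ℕ

-- Pigeonhole: a missed value could be punched out, giving an injection into a smaller set. Both
-- defining conditions of an AOA thereby reduce to injectivity.
injective⇒exactlyOne : (f : Fin n → Fin n) → Injective _≡_ _≡_ f →
                       ∀ y → ExactlyOne (λ r → f r ≡ y)
injective⇒exactlyOne {suc n} f f-injective y with any? (λ r → f r ≟ y)
... | yes (r , fr≡y) = r , fr≡y , λ r′ fr′≡y → f-injective (trans fr′≡y (sym fr≡y))
... | no  y-missed   = contradiction (injective⇒≤ avoid-y-injective) ℕ.1+n≰n
  where
  y≢f : ∀ r → y ≢ f r
  y≢f r y≡fr = y-missed (r , sym y≡fr)

  avoid-y : Fin (suc n) → Fin n
  avoid-y r = punchOut (y≢f r)

  avoid-y-injective : Injective _≡_ _≡_ avoid-y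
  avoid-y-injective {r} {r′} eq = f-injective (punchOut-injective (y≢f r) (y≢f r′) eq)

funToFin-cong : ∀ {k} {f g : Fin k → Fin n} → (∀ i → f i ≡ g i) → funToFin f ≡ funToFin g
funToFin-cong {k = 0}     f≗g = refl
funToFin-cong {k = suc k} f≗g = cong₂ combine (f≗g zero) (funToFin-cong (f≗g ∘ suc))

funToFin-injective : ∀ {k} (f g : Fin k → Fin n) → funToFin f ≡ funToFin g → ∀ i → f i ≡ g i
funToFin-injective f g eq i =
  trans (sym (finToFun-funToFin f i)) (trans (cong (λ r → finToFun r i) eq) (finToFun-funToFin g i))

finToFun-injective : ∀ k {r r′ : Fin (n ^ k)} → (∀ i → finToFun {n} {k} r i ≡ finToFun r′ i) → r ≡ r′
finToFun-injective {n} k {r} {r′} eq =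
  trans (sym (funToFin-finToFin {k} {n} r))
        (trans (funToFin-cong {k = k} eq) (funToFin-finToFin {k} {n} r′))

remQuot-injective : ∀ {i j : Fin (m * n)} → remQuot {m} n i ≡ remQuot n j → i ≡ j
remQuot-injective {m} {n} {i} {j} eq =
  trans (sym (combine-remQuot {m} n i)) (trans (cong (uncurry combine) eq) (combine-remQuot {m} n j))

-- Finite abelian groups and difference matrices.

-- Equality is a setoid relation so that quotients of ℤ fit. The two injections fix the order:
-- `element` gives at least n classes, `index` at most n.
record FiniteAbelianGroup (n : ℕ) : Set₁ where
  field
    abelianGroup : AbelianGroup 0ℓ 0ℓ
  open AbelianGroup abelianGroup public
  field
    _≈?_              : Decidable _≈_
    element           : Fin n → Carrier
    index             : Carrier → Fin n
    element-injective : ∀ {i j} → element i ≈ element j → i ≡ j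
    index-injective   : ∀ {x y} → index x ≡ index y → x ≈ y

-- A (G,4;1)-difference matrix with |G| = n, normalised so that the fourth row is zero.
record DifferenceMatrix (n : ℕ) : Set₁ where
  field
    G : FiniteAbelianGroup n
  open FiniteAbelianGroup G public
  field
    x y z : Fin n → Carrier
    x-injective   : ∀ {i j} → x i ≈ x j → i ≡ j
    y-injective   : ∀ {i j} → y i ≈ y j → i ≡ j
    z-injective   : ∀ {i j} → z i ≈ z j → i ≡ j
    y-x-injective : ∀ {i j} → y i - x i ≈ y j - x j → i ≡ j
    z-x-injective : ∀ {i j} → z i - x i ≈ z j - x j → i ≡ j
    z-y-injective : ∀ {i j} → z i - y i ≈ z j - y j → i ≡ j

-- The augmented orthogonal array of a difference matrix.

triples : List (List (Fin 5))
triples =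
  (0F ∷ 1F ∷ 2F ∷ []) ∷ (0F ∷ 1F ∷ 3F ∷ []) ∷ (0F ∷ 1F ∷ 4F ∷ []) ∷ (0F ∷ 2F ∷ 3F ∷ []) ∷
  (0F ∷ 2F ∷ 4F ∷ []) ∷ (0F ∷ 3F ∷ 4F ∷ []) ∷ (1F ∷ 2F ∷ 3F ∷ []) ∷ (1F ∷ 2F ∷ 4F ∷ []) ∷
  (1F ∷ 3F ∷ 4F ∷ []) ∷ (2F ∷ 3F ∷ 4F ∷ []) ∷ []

-- Reduces all ordered choices of three columns to ten unordered ones, by checking every triple of
-- indices.
distinct⇒triple : (i j k : Fin 5) → i ≢ j → i ≢ k → j ≢ k →
                  Any (All (_∈ i ∷ j ∷ k ∷ [])) triples
distinct⇒triple = from-yes (all? λ i → all? λ j → all? λ k →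
  ¬? (i ≟ j) →-dec ¬? (i ≟ k) →-dec ¬? (j ≟ k) →-dec
  Any.any? (All.all? (_∈? (i ∷ j ∷ k ∷ []))) triples)
  where open DecMembership (_≟_ {5}) using (_∈?_)

-- A row is indexed by (a , b , j) with a, b ∈ G and j a column of the difference matrix.
module FromDifferenceMatrix {v : ℕ} (D : DifferenceMatrix v) where

  open DifferenceMatrix D renaming (refl to ≈-refl; sym to ≈-sym; trans to ≈-trans)
  open AbelianGroupProperties abelianGroup
    using (∙-cancelˡ; ∙-cancelʳ; ⁻¹-injective; //-rightDividesˡ)
  open CommutativeMonoidSolver commutativeMonoid using (solve; _⊕_; _⊜_)
  open import Relation.Binary.Reasoning.Setoid setoid

  cell : Fin 5 → Carrier → Carrier → Fin v → Carrier
  cell 0F a b j = a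
  cell 1F a b j = a ∙ x j
  cell 2F a b j = b
  cell 3F a b j = b ∙ (z j - y j)
  cell 4F a b j = (a ∙ b) ∙ z j

  augment₁ augment₂ : Carrier → Carrier → Fin v → Carrier
  augment₁ a b j = a ∙ z j
  augment₂ a b j = b - y j

  -- This is how j is recovered: s is an entry, t a combination of other entries, and u, up to sign,
  -- a difference of two matrix rows at j, which determines j.
  cancel-sum : ∀ {s s′ t t′ u u′} → s ≈ t ∙ u → s′ ≈ t′ ∙ u′ → s ≈ s′ → t ≈ t′ → u ≈ u′
  cancel-sum {s} {s′} {t} {t′} {u} {u′} s≈tu s′≈t′u′ s≈s′ t≈t′ = ∙-cancelˡ t u u′ (begin
    t ∙ u   ≈⟨ s≈tu ⟨
    s       ≈⟨ s≈s′ ⟩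
    s′      ≈⟨ s′≈t′u′ ⟩
    t′ ∙ u′ ≈⟨ ∙-congʳ t≈t′ ⟨
    t ∙ u′  ∎)

  module _ (a b : Carrier) (j : Fin v) where

    4≈0∙3∙y : cell 4F a b j ≈ (cell 0F a b j ∙ cell 3F a b j) ∙ y j
    4≈0∙3∙y = begin
      (a ∙ b) ∙ z j                   ≈⟨ ∙-congˡ (//-rightDividesˡ (y j) (z j)) ⟨
      (a ∙ b) ∙ ((z j - y j) ∙ y j)   ≈⟨ solve 4 (λ a b w y → (a ⊕ b) ⊕ (w ⊕ y) ⊜ (a ⊕ (b ⊕ w)) ⊕ y)
                                           ≈-refl a b (z j - y j) (y j) ⟩
      (a ∙ (b ∙ (z j - y j))) ∙ y j   ∎

    4≈1∙2∙z-x : cell 4F a b j ≈ (cell 1F a b j ∙ cell 2F a b j) ∙ (z j - x j)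
    4≈1∙2∙z-x = begin
      (a ∙ b) ∙ z j                 ≈⟨ ∙-congˡ (//-rightDividesˡ (x j) (z j)) ⟨
      (a ∙ b) ∙ ((z j - x j) ∙ x j) ≈⟨ solve 4 (λ a b w x → (a ⊕ b) ⊕ (w ⊕ x) ⊜ ((a ⊕ x) ⊕ b) ⊕ w)
                                         ≈-refl a b (z j - x j) (x j) ⟩
      ((a ∙ x j) ∙ b) ∙ (z j - x j) ∎

    4≈1∙3∙y-x : cell 4F a b j ≈ (cell 1F a b j ∙ cell 3F a b j) ∙ (y j - x j)
    4≈1∙3∙y-x = begin
      (a ∙ b) ∙ z j                                   ≈⟨ 4≈0∙3∙y ⟩
      (a ∙ (b ∙ (z j - y j))) ∙ y j                   ≈⟨ ∙-congˡ (//-rightDividesˡ (x j) (y j)) ⟨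
      (a ∙ (b ∙ (z j - y j))) ∙ ((y j - x j) ∙ x j)   ≈⟨ solve 4 (λ a c w x → (a ⊕ c) ⊕ (w ⊕ x) ⊜ ((a ⊕ x) ⊕ c) ⊕ w)
                                                           ≈-refl a (b ∙ (z j - y j)) (y j - x j) (x j) ⟩
      ((a ∙ x j) ∙ (b ∙ (z j - y j))) ∙ (y j - x j)   ∎

    augment₁≈1∙z-x : augment₁ a b j ≈ cell 1F a b j ∙ (z j - x j)
    augment₁≈1∙z-x = begin
      a ∙ z j                 ≈⟨ ∙-congˡ (//-rightDividesˡ (x j) (z j)) ⟨
      a ∙ ((z j - x j) ∙ x j) ≈⟨ solve 3 (λ a w x → a ⊕ (w ⊕ x) ⊜ (a ⊕ x) ⊕ w) ≈-refl a (z j - x j) (x j) ⟩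
      (a ∙ x j) ∙ (z j - x j) ∎

    3≈augment₂∙z : cell 3F a b j ≈ augment₂ a b j ∙ z j
    3≈augment₂∙z = solve 3 (λ b z y⁻¹ → b ⊕ (z ⊕ y⁻¹) ⊜ (b ⊕ y⁻¹) ⊕ z) ≈-refl b (z j) (y j ⁻¹)

    4≈augment∙y : cell 4F a b j ≈ (augment₁ a b j ∙ augment₂ a b j) ∙ y j
    4≈augment∙y = begin
      (a ∙ b) ∙ z j                   ≈⟨ 4≈0∙3∙y ⟩
      (a ∙ (b ∙ (z j - y j))) ∙ y j   ≈⟨ ∙-congʳ (∙-congˡ 3≈augment₂∙z) ⟩
      (a ∙ ((b - y j) ∙ z j)) ∙ y j   ≈⟨ ∙-congʳ (solve 3 (λ a c z → a ⊕ (c ⊕ z) ⊜ (a ⊕ z) ⊕ c)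
                                                  ≈-refl a (b - y j) (z j)) ⟩
      ((a ∙ z j) ∙ (b - y j)) ∙ y j   ∎

  module TwoRows (a b : Carrier) (j : Fin v) (a′ b′ : Carrier) (j′ : Fin v) where

    Agree : Fin 5 → Set
    Agree k = cell k a b j ≈ cell k a′ b′ j′

    SameRow : Set
    SameRow = a ≈ a′ × b ≈ b′ × j ≡ j′

    from-01 : a ≈ a′ → Agree 1F → j ≡ j′
    from-01 e₀ e₁ = x-injective (cancel-sum ≈-refl ≈-refl e₁ e₀)

    from-23 : b ≈ b′ → Agree 3F → j ≡ j′
    from-23 e₂ e₃ = z-y-injective (cancel-sum ≈-refl ≈-refl e₃ e₂)

    from-024 : a ≈ a′ → b ≈ b′ → Agree 4F → j ≡ j′
    from-024 e₀ e₂ e₄ = z-injective (cancel-sum ≈-refl ≈-refl e₄ (∙-cong e₀ e₂))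

    from-034 : a ≈ a′ → Agree 3F → Agree 4F → j ≡ j′
    from-034 e₀ e₃ e₄ = y-injective
      (cancel-sum (4≈0∙3∙y a b j) (4≈0∙3∙y a′ b′ j′) e₄ (∙-cong e₀ e₃))

    from-124 : Agree 1F → b ≈ b′ → Agree 4F → j ≡ j′
    from-124 e₁ e₂ e₄ = z-x-injective
      (cancel-sum (4≈1∙2∙z-x a b j) (4≈1∙2∙z-x a′ b′ j′) e₄ (∙-cong e₁ e₂))

    from-134 : Agree 1F → Agree 3F → Agree 4F → j ≡ j′
    from-134 e₁ e₃ e₄ = y-x-injective
      (cancel-sum (4≈1∙3∙y-x a b j) (4≈1∙3∙y-x a′ b′ j′) e₄ (∙-cong e₁ e₃))

    a-from-1 : j ≡ j′ → Agree 1F → a ≈ a′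
    a-from-1 refl = ∙-cancelʳ (x j) a a′

    b-from-3 : j ≡ j′ → Agree 3F → b ≈ b′
    b-from-3 refl = ∙-cancelʳ (z j - y j) b b′

    a∙b-from-4 : j ≡ j′ → Agree 4F → a ∙ b ≈ a′ ∙ b′
    a∙b-from-4 refl = ∙-cancelʳ (z j) (a ∙ b) (a′ ∙ b′)

    a-from-4 : j ≡ j′ → b ≈ b′ → Agree 4F → a ≈ a′
    a-from-4 j≡j′ b≈b′ e₄ = ∙-cancelʳ b a a′ (≈-trans (a∙b-from-4 j≡j′ e₄) (∙-congˡ (≈-sym b≈b′)))

    b-from-4 : j ≡ j′ → a ≈ a′ → Agree 4F → b ≈ b′
    b-from-4 j≡j′ a≈a′ e₄ = ∙-cancelˡ a b b′ (≈-trans (a∙b-from-4 j≡j′ e₄) (∙-congʳ (≈-sym a≈a′)))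

    -- First j is found. Triples containing 0 and 1 use x, those containing 2 and 3 use z - y, and
    -- the remaining 024, 034, 124, 134 use z, y, z - x, y - x. Then a and b follow by cancellation
    -- at the common j.
    agree-on-triple : Any (All Agree) triples → SameRow
    agree-on-triple (here (e₀ ∷ e₁ ∷ e₂ ∷ [])) = e₀ , e₂ , from-01 e₀ e₁
    agree-on-triple (there (here (e₀ ∷ e₁ ∷ e₃ ∷ []))) =
      let j≡j′ = from-01 e₀ e₁ in e₀ , b-from-3 j≡j′ e₃ , j≡j′
    agree-on-triple (there (there (here (e₀ ∷ e₁ ∷ e₄ ∷ [])))) =
      let j≡j′ = from-01 e₀ e₁ in e₀ , b-from-4 j≡j′ e₀ e₄ , j≡j′
    agree-on-triple (there (there (there (here (e₀ ∷ e₂ ∷ e₃ ∷ []))))) = e₀ , e₂ , from-23 e₂ e₃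
    agree-on-triple (there (there (there (there (here (e₀ ∷ e₂ ∷ e₄ ∷ [])))))) =
      e₀ , e₂ , from-024 e₀ e₂ e₄
    agree-on-triple (there (there (there (there (there (here (e₀ ∷ e₃ ∷ e₄ ∷ []))))))) =
      let j≡j′ = from-034 e₀ e₃ e₄ in e₀ , b-from-3 j≡j′ e₃ , j≡j′
    agree-on-triple (there (there (there (there (there (there (here (e₁ ∷ e₂ ∷ e₃ ∷ [])))))))) =
      let j≡j′ = from-23 e₂ e₃ in a-from-1 j≡j′ e₁ , e₂ , j≡j′
    agree-on-triple (there (there (there (there (there (there (there (here (e₁ ∷ e₂ ∷ e₄ ∷ []))))))))) =
      let j≡j′ = from-124 e₁ e₂ e₄ in a-from-1 j≡j′ e₁ , e₂ , j≡j′
    agree-on-triple (there (there (there (there (there (there (there (there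
                      (here (e₁ ∷ e₃ ∷ e₄ ∷ [])))))))))) =
      let j≡j′ = from-134 e₁ e₃ e₄ in a-from-1 j≡j′ e₁ , b-from-3 j≡j′ e₃ , j≡j′
    agree-on-triple (there (there (there (there (there (there (there (there (there
                      (here (e₂ ∷ e₃ ∷ e₄ ∷ []))))))))))) =
      let j≡j′ = from-23 e₂ e₃ in a-from-4 j≡j′ e₂ e₄ , e₂ , j≡j′

    module _ (f₁ : augment₁ a b j ≈ augment₁ a′ b′ j′) (f₂ : augment₂ a b j ≈ augment₂ a′ b′ j′) where

      -- Combining column k with the pair (a + z , b - y) isolates z for k = 0 and 3, z - x for k =
      -- 1, and y (up to sign) for k = 2 and 4.
      j-from-augment : ∀ k → Agree k → j ≡ j′
      j-from-augment 0F e₀ = z-injective (cancel-sum ≈-refl ≈-refl f₁ e₀)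
      j-from-augment 1F e₁ = z-x-injective
        (cancel-sum (augment₁≈1∙z-x a b j) (augment₁≈1∙z-x a′ b′ j′) f₁ e₁)
      j-from-augment 2F e₂ = y-injective (⁻¹-injective (cancel-sum ≈-refl ≈-refl f₂ e₂))
      j-from-augment 3F e₃ = z-injective
        (cancel-sum (3≈augment₂∙z a b j) (3≈augment₂∙z a′ b′ j′) e₃ f₂)
      j-from-augment 4F e₄ = y-injective
        (cancel-sum (4≈augment∙y a b j) (4≈augment∙y a′ b′ j′) e₄ (∙-cong f₁ f₂))

      agree-with-augment : ∀ k → Agree k → SameRow
      agree-with-augment k eₖ with j-from-augment k eₖ
      ... | refl = ∙-cancelʳ (z j) a a′ f₁ , ∙-cancelʳ (y j ⁻¹) b b′ f₂ , refl

  rowA rowB : Fin (v ^ 3) → Carrier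
  rowA r = element (finToFun {v} {3} r 0F)
  rowB r = element (finToFun {v} {3} r 1F)

  rowJ : Fin (v ^ 3) → Fin v
  rowJ r = finToFun {v} {3} r 2F

  module Rows (r r′ : Fin (v ^ 3)) = TwoRows (rowA r) (rowB r) (rowJ r) (rowA r′) (rowB r′) (rowJ r′)

  row-injective : ∀ {r r′} → Rows.SameRow r r′ → r ≡ r′
  row-injective (a≈a′ , b≈b′ , j≡j′) = finToFun-injective {v} 3 λ where
    0F → element-injective a≈a′
    1F → element-injective b≈b′
    2F → j≡j′

  array : Array 3 5 v
  array r k = index (cell k (rowA r) (rowB r) (rowJ r))

  augmentation : Fin (v ^ 3) → Fin (v ^ 2)
  augmentation r = combine (index (augment₁ (rowA r) (rowB r) (rowJ r)))
                           -- `v ^ 2` unfolds to `v * (v * 1)`, so the innermost factor `Fin 1` is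
                           -- filled with zero.
                           (combine (index (augment₂ (rowA r) (rowB r) (rowJ r))) (zero {0}))

  array-isOA : IsOA 3 5 v array
  array-isOA (c , c-injective) t =
    let r , fr≡t , r-unique = injective⇒exactlyOne restrict restrict-injective (funToFin t)
    in r , funToFin-injective (array r ∘ c) t fr≡t , λ r′ agree → r-unique r′ (funToFin-cong agree)
    where
    -- Packing the three chosen entries into one index makes this a self-map of a finite set, so
    -- injectivity suffices.
    restrict : Fin (v ^ 3) → Fin (v ^ 3)
    restrict r = funToFin (array r ∘ c)

    distinct : ∀ {i j} → i ≢ j → c i ≢ c j
    distinct i≢j = i≢j ∘ c-injective

    restrict-injective : Injective _≡_ _≡_ restrict
    restrict-injective {r} {r′} eq = row-injective {r} {r′} (Rows.agree-on-triple r r′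
      (Any.map (All.map agree) (distinct⇒triple (c 0F) (c 1F) (c 2F)
        (distinct λ ()) (distinct λ ()) (distinct λ ()))))
      where
      agree-on-c : ∀ i → Rows.Agree r r′ (c i)
      agree-on-c i = index-injective (funToFin-injective (array r ∘ c) (array r′ ∘ c) eq i)

      agree : ∀ {k} → k ∈ c 0F ∷ c 1F ∷ c 2F ∷ [] → Rows.Agree r r′ k
      agree (here refl)                 = agree-on-c 0F
      agree (there (here refl))         = agree-on-c 1F
      agree (there (there (here refl))) = agree-on-c 2F

  array-augmented : ((c , _) : Columns 1 5) (t : Fin 1 → Fin v) (s : Fin (v ^ 2)) →
                    ExactlyOne (λ r → (∀ i → array r (c i) ≡ t i) × augmentation r ≡ s)
  array-augmented (c , _) t s =
    let r , fr≡ts , r-unique = injective⇒exactlyOne restrict restrict-injective (combine (t 0F) s)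
        eqₜ , eqₛ = combine-injective _ _ _ _ fr≡ts
    in r , ((λ where 0F → eqₜ) , eqₛ) , λ r′ (agreeₜ , agreeₛ) → r-unique r′ (cong₂ combine (agreeₜ 0F) agreeₛ)
    where
    restrict : Fin (v ^ 3) → Fin (v ^ 3)
    restrict r = combine (array r (c 0F)) (augmentation r)

    restrict-injective : Injective _≡_ _≡_ restrict
    restrict-injective {r} {r′} eq =
      let eqₖ , eqₗ = combine-injective _ _ _ _ eq
          eq₁ , eqₗ′ = combine-injective _ _ _ _ eqₗ
          eq₂ , _ = combine-injective _ _ _ _ eqₗ′
      in row-injective {r} {r′} (Rows.agree-with-augment r r′
           (index-injective eq₁) (index-injective eq₂) (c 0F) (index-injective eqₖ))

  aoa : AOA 1 3 5 v
  aoa = record { A = array ; L = augmentation ; isOA = array-isOA ; augm = array-augmented }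

-- Cyclic groups.

-- The absolute value of the difference is a multiple of n below n, hence zero.
residue-injective : ∀ {i j} → i < n → j < n → + n ∣ + i ℤ.- + j → i ≡ j
residue-injective {n@(suc _)} {i} {j} i<n j<n n∣i-j =
  ℤ.+-injective (ℤ.i-j≡0⇒i≡j (+ i) (+ j) (ℤ.∣i∣≡0⇒i≡0 ∣i-j∣≡0))
  where
  ∣i-j∣<n : ℤ.∣ + i ℤ.- + j ∣ < n
  ∣i-j∣<n = ℕ.≤-<-trans
    (ℕ.≤-trans (ℕ.≤-reflexive (cong ℤ.∣_∣ (ℤ.m-n≡m⊖n i j))) (ℤ.∣m⊝n∣≤m⊔n i j))
    (ℕ.⊔-lub i<n j<n)

  ∣i-j∣≡0 : ℤ.∣ + i ℤ.- + j ∣ ≡ 0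
  ∣i-j∣≡0 = trans (sym (m<n⇒m%n≡m ∣i-j∣<n)) (ℕ.n∣m⇒m%n≡0 _ n (∣⇒∣ᵤ n∣i-j))

cancel-coprime : ∀ k a b → Coprime n k → + n ∣ + k ℤ.* a ℤ.- + k ℤ.* b → + n ∣ a ℤ.- b
cancel-coprime k a b n⊥k n∣ka-kb = ∣ᵤ⇒∣ (coprime-divisor n⊥k
  (subst (_ ℕ.∣_) (trans (cong ℤ.∣_∣ (factor-out (+ k) a b)) (ℤ.abs-* (+ k) (a ℤ.- b))) (∣⇒∣ᵤ n∣ka-kb)))
  where
  factor-out : ∀ k a b → k ℤ.* a ℤ.- k ℤ.* b ≡ k ℤ.* (a ℤ.- b)
  factor-out = solve-∀

-- The carrier is ℤ under congruence modulo n, so identities between group elements become ring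
-- identities over ℤ.
cyclic : ∀ n → .{{NonZero n}} → FiniteAbelianGroup n
cyclic n = record
  { abelianGroup = record
    { Carrier = ℤ
    ; _≈_ = λ a b → + n ∣ a ℤ.- b
    ; _∙_ = ℤ._+_
    ; ε = 0ℤ
    ; _⁻¹ = ℤ.-_
    ; isAbelianGroup = record
      { isGroup = record
        { isMonoid = record
          { isSemigroup = record
            { isMagma = record
              { isEquivalence = record
                { refl = λ {a} → reflexive {a} refl
                ; sym = λ {a} {b} n∣a-b → subst (+ n ∣_) (neg-sub a b) (∣m⇒∣-m n∣a-b)
                ; trans = λ {a} {b} {c} n∣a-b n∣b-c → subst (+ n ∣_) (sub-sub a b c) (∣m∣n⇒∣m+n n∣a-b n∣b-c)
                }
              ; ∙-cong = λ {a} {b} {c} {d} n∣a-b n∣c-d → subst (+ n ∣_) (add-sub a b c d) (∣m∣n⇒∣m+n n∣a-b n∣c-d)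
              }
            ; assoc = λ a b c → reflexive (ℤ.+-assoc a b c)
            }
          ; identity = reflexive ∘ ℤ.+-identityˡ , reflexive ∘ ℤ.+-identityʳ
          }
        ; inverse = reflexive ∘ ℤ.+-inverseˡ , reflexive ∘ ℤ.+-inverseʳ
        ; ⁻¹-cong = λ {a} {b} n∣a-b → subst (+ n ∣_) (neg-add a b) (∣m⇒∣-m n∣a-b)
        }
      ; comm = λ a b → reflexive (ℤ.+-comm a b)
      }
    }
  ; _≈?_ = λ a b → + n ∣? a ℤ.- b
  ; element = λ i → + toℕ i
  ; index = λ a → fromℕ< (n%ℕd<d a n)
  ; element-injective = λ {i} {j} n∣i-j → toℕ-injective (residue-injective (toℕ<n i) (toℕ<n j) n∣i-j)
  ; index-injective = λ {a} {b} eq → same-remainder a b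
      (fromℕ<-injective _ _ (n%ℕd<d a n) (n%ℕd<d b n) eq)
  }
  where
  reflexive : ∀ {a b} → a ≡ b → + n ∣ a ℤ.- b
  reflexive {a} refl = divides 0ℤ (ℤ.+-inverseʳ a)

  neg-sub : ∀ a b → ℤ.- (a ℤ.- b) ≡ b ℤ.- a
  neg-sub = solve-∀

  sub-sub : ∀ a b c → (a ℤ.- b) ℤ.+ (b ℤ.- c) ≡ a ℤ.- c
  sub-sub = solve-∀

  add-sub : ∀ a b c d → (a ℤ.- b) ℤ.+ (c ℤ.- d) ≡ (a ℤ.+ c) ℤ.- (b ℤ.+ d)
  add-sub = solve-∀

  neg-add : ∀ a b → ℤ.- (a ℤ.- b) ≡ (ℤ.- a) ℤ.- (ℤ.- b)
  neg-add = solve-∀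

  same-remainder : ∀ a b → a %ℕ n ≡ b %ℕ n → + n ∣ a ℤ.- b
  same-remainder a b eq = divides (a /ℕ n ℤ.- b /ℕ n) (begin
    a ℤ.- b
      ≡⟨ cong₂ ℤ._-_ (a≡a%ℕn+[a/ℕn]*n a n) (a≡a%ℕn+[a/ℕn]*n b n) ⟩
    (+ (a %ℕ n) ℤ.+ a /ℕ n ℤ.* + n) ℤ.- (+ (b %ℕ n) ℤ.+ b /ℕ n ℤ.* + n)
      ≡⟨ cong (λ r → (+ r ℤ.+ a /ℕ n ℤ.* + n) ℤ.- (+ (b %ℕ n) ℤ.+ b /ℕ n ℤ.* + n)) eq ⟩
    (+ (b %ℕ n) ℤ.+ a /ℕ n ℤ.* + n) ℤ.- (+ (b %ℕ n) ℤ.+ b /ℕ n ℤ.* + n)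
      ≡⟨ cancel-remainder (+ (b %ℕ n)) (a /ℕ n) (b /ℕ n) (+ n) ⟩
    (a /ℕ n ℤ.- b /ℕ n) ℤ.* + n ∎)
    where
    open ≡-Reasoning
    cancel-remainder : ∀ r s t d → (r ℤ.+ s ℤ.* d) ℤ.- (r ℤ.+ t ℤ.* d) ≡ (s ℤ.- t) ℤ.* d
    cancel-remainder = solve-∀

-- Direct products.

infixr 7 _⊗_

_⊗_ : FiniteAbelianGroup m → FiniteAbelianGroup n → FiniteAbelianGroup (m * n)
_⊗_ {m} {n} G H = record
  { abelianGroup = DirectProduct.abelianGroup G.abelianGroup H.abelianGroup
  ; _≈?_ = ×-decidable G._≈?_ H._≈?_
  ; element = λ i → G.element (proj₁ (remQuot {m} n i)) , H.element (proj₂ (remQuot {m} n i))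
  ; index = λ (g , h) → combine (G.index g) (H.index h)
  ; element-injective = λ (eq₁ , eq₂) →
      remQuot-injective (cong₂ _,_ (G.element-injective eq₁) (H.element-injective eq₂))
  ; index-injective = λ eq →
      let eq₁ , eq₂ = combine-injective _ _ _ _ eq in G.index-injective eq₁ , H.index-injective eq₂
  }
  where
  module G = FiniteAbelianGroup G
  module H = FiniteAbelianGroup H

infixr 7 _⊠_

_⊠_ : DifferenceMatrix m → DifferenceMatrix n → DifferenceMatrix (m * n)
_⊠_ {m} {n} D E = record
  { G = D.G ⊗ E.G
  ; x = pair D.x E.x
  ; y = pair D.y E.y
  ; z = pair D.z E.z
  ; x-injective = λ (p , q) → componentwise (D.x-injective p) (E.x-injective q)
  ; y-injective = λ (p , q) → componentwise (D.y-injective p) (E.y-injective q)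
  ; z-injective = λ (p , q) → componentwise (D.z-injective p) (E.z-injective q)
  ; y-x-injective = λ (p , q) → componentwise (D.y-x-injective p) (E.y-x-injective q)
  ; z-x-injective = λ (p , q) → componentwise (D.z-x-injective p) (E.z-x-injective q)
  ; z-y-injective = λ (p , q) → componentwise (D.z-y-injective p) (E.z-y-injective q)
  }
  where
  module D = DifferenceMatrix D
  module E = DifferenceMatrix E

  pair : ∀ {A B : Set} → (Fin m → A) → (Fin n → B) → Fin (m * n) → A × B
  pair f g i = f (proj₁ (remQuot {m} n i)) , g (proj₂ (remQuot {m} n i))

  componentwise : ∀ {i j} → proj₁ (remQuot {m} n i) ≡ proj₁ (remQuot {m} n j) →
                  proj₂ (remQuot {m} n i) ≡ proj₂ (remQuot {m} n j) → i ≡ j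
  componentwise p q = remQuot-injective (cong₂ _,_ p q)

-- Difference matrices from orthomorphisms.

module _ (G : FiniteAbelianGroup n) where

  open FiniteAbelianGroup G renaming (refl to ≈-refl; sym to ≈-sym; trans to ≈-trans)
  open AbelianGroupProperties abelianGroup using (xyx⁻¹≈y; //-rightDividesʳ)

  -- For the rows 1, α, 1 + α the six conditions concern 1, α, 1 + α, α - 1, α, 1 in turn.
  fromOrthomorphism : (α : Carrier → Carrier) →
    (∀ {a b} → α a ≈ α b → a ≈ b) →
    (∀ {a b} → a ∙ α a ≈ b ∙ α b → a ≈ b) →
    (∀ {a b} → α a - a ≈ α b - b → a ≈ b) →
    DifferenceMatrix n
  fromOrthomorphism α α-injective +-injective ∸-injective = record
    { G = G
    ; x = element
    ; y = λ i → α (element i)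
    ; z = λ i → element i ∙ α (element i)
    ; x-injective = element-injective
    ; y-injective = element-injective ∘ α-injective
    ; z-injective = element-injective ∘ +-injective
    ; y-x-injective = element-injective ∘ ∸-injective
    ; z-x-injective = λ eq → element-injective (α-injective
        (≈-trans (≈-sym (xyx⁻¹≈y _ _)) (≈-trans eq (xyx⁻¹≈y _ _))))
    ; z-y-injective = λ eq → element-injective
        (≈-trans (≈-sym (//-rightDividesʳ _ _)) (≈-trans eq (//-rightDividesʳ _ _)))
    }

module _ (G : FiniteAbelianGroup n) where

  open FiniteAbelianGroup G renaming (refl to ≈-refl; sym to ≈-sym; trans to ≈-trans)
  open AbelianGroupProperties abelianGroup
    using (∙-cancelʳ; //-rightDividesˡ; //-rightDividesʳ)
  open import Relation.Binary.Reasoning.Setoid setoid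

  private
    variable
      a b c a′ b′ c′ : Carrier

    cancelʳ : b ≈ b′ → a ∙ b ≈ a′ ∙ b′ → a ≈ a′
    cancelʳ {b} {a = a} {a′ = a′} b≈b′ eq = ∙-cancelʳ b a a′ (≈-trans eq (∙-congˡ (≈-sym b≈b′)))

    cancel-subtrahend : a ≈ a′ → b - a ≈ b′ - a′ → b ≈ b′
    cancel-subtrahend a≈a′ = cancelʳ (⁻¹-cong a≈a′)

    cancel-summand : (a ∙ b) - b ≈ (a′ ∙ b′) - b′ → a ≈ a′
    cancel-summand eq = ≈-trans (≈-sym (//-rightDividesʳ _ _)) (≈-trans eq (//-rightDividesʳ _ _))

    telescope : ∀ a b c → (a - b) ∙ (b - c) ≈ a - c
    telescope a b c = begin
      (a - b) ∙ (b - c)      ≈⟨ assoc (a - b) b (c ⁻¹) ⟨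
      ((a - b) ∙ b) ∙ c ⁻¹   ≈⟨ ∙-congʳ (//-rightDividesˡ b a) ⟩
      a - c                  ∎

  -- α² = α + 1, so α - 1 is the inverse of α, and α + 1 is its square.
  square : DifferenceMatrix (n * n)
  square = fromOrthomorphism (G ⊗ G) (λ (a , b) → b , a ∙ b)
    (λ (b≈ , ab≈) → cancelʳ b≈ ab≈ , b≈)
    (λ (ab≈ , bab≈) → let b≈ = cancelʳ ab≈ bab≈ in cancelʳ b≈ ab≈ , b≈)
    (λ (b-a≈ , ab-b≈) → let a≈ = cancel-summand ab-b≈ in a≈ , cancel-subtrahend a≈ b-a≈)

  -- α³ = α + 1, so α (α - 1) (α + 1) = 1.
  cube : DifferenceMatrix (n * (n * n))
  cube = fromOrthomorphism (G ⊗ (G ⊗ G)) (λ (a , b , c) → c , a ∙ c , b)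
    (λ (c≈ , ac≈ , b≈) → cancelʳ c≈ ac≈ , b≈ , c≈)
    (λ (ac≈ , bac≈ , cb≈) →
      let b≈ = cancelʳ ac≈ bac≈
          c≈ = cancelʳ b≈ cb≈
      in cancelʳ c≈ ac≈ , b≈ , c≈)
    (λ {(a , b , c)} {(a′ , b′ , c′)} (c-a≈ , ac-b≈ , b-c≈) →
      -- Adding the last two components eliminates b and leaves a.
      let a≈ = cancel-summand (begin
                 (a ∙ c) - c                   ≈⟨ telescope (a ∙ c) b c ⟨
                 ((a ∙ c) - b) ∙ (b - c)       ≈⟨ ∙-cong ac-b≈ b-c≈ ⟩
                 ((a′ ∙ c′) - b′) ∙ (b′ - c′)  ≈⟨ telescope (a′ ∙ c′) b′ c′ ⟩
                 (a′ ∙ c′) - c′                ∎)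
          c≈ = cancel-subtrahend a≈ c-a≈
      in a≈ , cancel-subtrahend c≈ b-c≈ , c≈)

-- For α = 2 the maps α, α + 1, α - 1 are multiplication by 2, 3 and 1, all units modulo n.
coprimeToSix : .{{_ : NonZero n}} → Coprime n 2 → Coprime n 3 → DifferenceMatrix n
coprimeToSix {n} n⊥2 n⊥3 = fromOrthomorphism (cyclic n) (λ a → a ℤ.+ a)
  (λ {a} {b} eq → cancel-coprime 2 a b n⊥2 (subst (+ n ∣_) (double a b) eq))
  (λ {a} {b} eq → cancel-coprime 3 a b n⊥3 (subst (+ n ∣_) (triple a b) eq))
  (λ {a} {b} eq → subst (+ n ∣_) (single a b) eq)
  where
  single : ∀ a b → ((a ℤ.+ a) ℤ.- a) ℤ.- ((b ℤ.+ b) ℤ.- b) ≡ a ℤ.- b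
  single = solve-∀

  double : ∀ a b → (a ℤ.+ a) ℤ.- (b ℤ.+ b) ≡ + 2 ℤ.* a ℤ.- + 2 ℤ.* b
  double = solve-∀

  triple : ∀ a b → (a ℤ.+ (a ℤ.+ a)) ℤ.- (b ℤ.+ (b ℤ.+ b)) ≡ + 3 ℤ.* a ℤ.- + 3 ℤ.* b
  triple = solve-∀

-- Attaching a factor ℤ/3; orders 12 and 24.

-- One triple for each of the three copies B; its entries are the ℤ/3-components of the rows x, y
-- and z.
Lifts : Set
Lifts = Vec (ℕ × ℕ × ℕ) 3

lift₁ lift₂ lift₃ : Lifts → Fin 3 → ℤ
lift₁ ℓ B = + proj₁ (lookup ℓ B)
lift₂ ℓ B = + proj₁ (proj₂ (lookup ℓ B))
lift₃ ℓ B = + proj₂ (proj₂ (lookup ℓ B))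

-- Without the shifts, the three columns at k = 0 would form a difference matrix over ℤ/3 with four
-- rows, which does not exist.
module LiftedRows (K : FiniteAbelianGroup n)
                  (α : FiniteAbelianGroup.Carrier K → FiniteAbelianGroup.Carrier K)
                  (shift : Fin 3 → FiniteAbelianGroup.Carrier K) (lifts : Fin n → Lifts) where

  open FiniteAbelianGroup K using (Carrier; _∙_; element)
  open FiniteAbelianGroup (K ⊗ cyclic 3) using () renaming (_≈_ to _≋_; _≈?_ to _≋?_; _-_ to _⊝_)

  x y z : Fin n → Fin 3 → Carrier × ℤ
  x k B = element k , lift₁ (lifts k) B
  y k B = α (element k) ∙ shift B , lift₂ (lifts k) B
  z k B = element k ∙ α (element k) , lift₃ (lifts k) B

  difference : Fin 6 → Fin n → Fin 3 → Carrier × ℤ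
  difference 0F k B = x k B
  difference 1F k B = y k B
  difference 2F k B = z k B
  difference 3F k B = y k B ⊝ x k B
  difference 4F k B = z k B ⊝ x k B
  difference 5F k B = z k B ⊝ y k B

  column : Fin 6 → Fin (n * 3) → Carrier × ℤ
  column p i = difference p (proj₁ (remQuot {n} 3 i)) (proj₂ (remQuot {n} 3 i))

  Separating : Fin 6 → Set
  Separating p = ∀ i j → column p i ≋ column p j → i ≡ j

  separating? : ∀ p → Dec (Separating p)
  separating? p = all? λ i → all? λ j → (column p i ≋? column p j) →-dec (i ≟ j)

  lifted : (∀ p → Separating p) → DifferenceMatrix (n * 3)
  lifted separating = record
    { G = K ⊗ cyclic 3
    ; x = column 0F
    ; y = column 1F
    ; z = column 2F
    ; x-injective = separating 0F _ _
    ; y-injective = separating 1F _ _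
    ; z-injective = separating 2F _ _
    ; y-x-injective = separating 3F _ _
    ; z-x-injective = separating 4F _ _
    ; z-y-injective = separating 5F _ _
    }

-- The map α is the one of `square` over ℤ/2; the table is verified by comparing all pairs of
-- columns.
order-12 : DifferenceMatrix 12
order-12 = lifted (from-yes (all? separating?))
  where
  table : Vec Lifts 4
  table =
    ((0 , 0 , 0) ∷ (2 , 2 , 1) ∷ (1 , 0 , 2) ∷ []) ∷
    ((0 , 0 , 1) ∷ (1 , 1 , 0) ∷ (2 , 0 , 2) ∷ []) ∷
    ((0 , 1 , 1) ∷ (1 , 2 , 0) ∷ (2 , 1 , 2) ∷ []) ∷
    ((1 , 2 , 2) ∷ (0 , 2 , 0) ∷ (2 , 1 , 1) ∷ []) ∷ []

  α : ℤ × ℤ → ℤ × ℤ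
  α (a , b) = b , a ℤ.+ b

  shift : Fin 3 → ℤ × ℤ
  shift 0F = + 0 , + 0
  shift 1F = + 0 , + 1
  shift 2F = + 1 , + 0

  open LiftedRows (cyclic 2 ⊗ cyclic 2) α shift (lookup table)

-- As for order 12, with the map α of `cube` over ℤ/2.
order-24 : DifferenceMatrix 24
order-24 = lifted (from-yes (all? separating?))
  where
  table : Vec Lifts 8
  table =
    ((0 , 0 , 0) ∷ (2 , 0 , 1) ∷ (1 , 0 , 2) ∷ []) ∷
    ((2 , 0 , 2) ∷ (1 , 1 , 0) ∷ (0 , 2 , 1) ∷ []) ∷
    ((2 , 2 , 0) ∷ (0 , 1 , 2) ∷ (1 , 0 , 1) ∷ []) ∷
    ((2 , 0 , 0) ∷ (1 , 1 , 1) ∷ (0 , 2 , 2) ∷ []) ∷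
    ((1 , 2 , 1) ∷ (2 , 2 , 0) ∷ (0 , 2 , 2) ∷ []) ∷
    ((1 , 1 , 0) ∷ (2 , 1 , 2) ∷ (0 , 2 , 1) ∷ []) ∷
    ((0 , 1 , 0) ∷ (1 , 1 , 2) ∷ (2 , 1 , 1) ∷ []) ∷
    ((0 , 0 , 0) ∷ (2 , 0 , 1) ∷ (1 , 2 , 2) ∷ []) ∷ []

  α : ℤ × ℤ × ℤ → ℤ × ℤ × ℤ
  α (a , b , c) = c , a ℤ.+ c , b

  shift : Fin 3 → ℤ × ℤ × ℤ
  shift 0F = + 0 , + 0 , + 0
  shift 1F = + 0 , + 0 , + 1
  shift 2F = + 0 , + 1 , + 0

  open LiftedRows (cyclic 2 ⊗ (cyclic 2 ⊗ cyclic 2)) α shift (lookup table)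

-- Cyclic words and the orders 3m.

-- A letter is a position on one of three loops; numbering the letters makes statements about all of
-- them decidable.
Letter : Set
Letter = Fin 12

pattern p₀ = 0F
pattern p₁ = 1F
pattern p₂ = 2F
pattern q₀ = 3F
pattern q₁ = 4F
pattern q₂ = 5F
pattern q₃ = 6F
pattern r₀ = 7F
pattern r₁ = 8F
pattern r₂ = 9F
pattern r₃ = suc 9F
pattern r₄ = suc (suc 9F)

-- The loops p, q and r have lengths 3, 4 and 5 and can be followed by each other, so there are closed
-- walks of every length 3a + 4 and 3a + 5.
followers : Letter → List Letter
followers p₀ = p₁ ∷ []
followers p₁ = p₂ ∷ []
followers p₂ = p₀ ∷ q₀ ∷ r₀ ∷ []
followers q₀ = q₁ ∷ []
followers q₁ = q₂ ∷ []
followers q₂ = q₃ ∷ []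
followers q₃ = p₀ ∷ q₀ ∷ r₀ ∷ []
followers r₀ = r₁ ∷ []
followers r₁ = r₂ ∷ []
followers r₂ = r₃ ∷ []
followers r₃ = r₄ ∷ []
followers r₄ = p₀ ∷ q₀ ∷ r₀ ∷ []

reachable : ℕ → Letter → List Letter
reachable 0       s = s ∷ []
reachable (suc δ) s = concatMap (reachable δ) (followers s)

-- Found by a computer search for exact covers.
lifts : Letter → Lifts
lifts p₀ = (2 , 2 , 1) ∷ (0 , 2 , 0) ∷ (1 , 2 , 2) ∷ []
lifts p₁ = (1 , 1 , 0) ∷ (2 , 1 , 2) ∷ (0 , 1 , 1) ∷ []
lifts p₂ = (0 , 0 , 2) ∷ (1 , 0 , 1) ∷ (2 , 0 , 0) ∷ []
lifts q₀ = (2 , 2 , 0) ∷ (1 , 1 , 1) ∷ (0 , 2 , 2) ∷ []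
lifts q₁ = (2 , 2 , 0) ∷ (1 , 1 , 1) ∷ (0 , 2 , 2) ∷ []
lifts q₂ = (1 , 0 , 2) ∷ (0 , 1 , 0) ∷ (2 , 0 , 1) ∷ []
lifts q₃ = (1 , 0 , 2) ∷ (0 , 1 , 0) ∷ (2 , 0 , 1) ∷ []
lifts r₀ = (2 , 2 , 1) ∷ (1 , 1 , 2) ∷ (0 , 0 , 0) ∷ []
lifts r₁ = (2 , 2 , 0) ∷ (1 , 1 , 1) ∷ (0 , 2 , 2) ∷ []
lifts r₂ = (0 , 2 , 1) ∷ (2 , 1 , 2) ∷ (1 , 0 , 0) ∷ []
lifts r₃ = (1 , 0 , 2) ∷ (0 , 1 , 0) ∷ (2 , 0 , 1) ∷ []
lifts r₄ = (1 , 2 , 1) ∷ (0 , 1 , 2) ∷ (2 , 0 , 0) ∷ []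

-- The ℤ/m-component of the p-th difference in column (t , B) is factor p · (t + displacement p B).
factor : Fin 6 → ℕ
factor 0F = 1
factor 1F = 2
factor 2F = 3
factor 3F = 1
factor 4F = 2
factor 5F = 1

displacement : Fin 6 → Fin 3 → ℤ
displacement 0F B = 0ℤ
displacement 1F B = + toℕ B
displacement 2F B = 0ℤ
displacement 3F B = + toℕ B ℤ.+ + toℕ B
displacement 4F B = 0ℤ
displacement 5F B = ℤ.- (+ toℕ B ℤ.+ + toℕ B)

liftDifference : Fin 6 → Letter → Fin 3 → ℤ
liftDifference 0F s B = lift₁ (lifts s) B
liftDifference 1F s B = lift₂ (lifts s) B
liftDifference 2F s B = lift₃ (lifts s) B
liftDifference 3F s B = lift₂ (lifts s) B ℤ.- lift₁ (lifts s) B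
liftDifference 4F s B = lift₃ (lifts s) B ℤ.- lift₁ (lifts s) B
liftDifference 5F s B = lift₃ (lifts s) B ℤ.- lift₂ (lifts s) B

-- Here d is the distance along the word from a column with letter s to a column with the same
-- ℤ/m-component; for negative d the two columns are exchanged.
Separated : ℤ → Fin 6 → Letter → Fin 3 → Fin 3 → Set
Separated (+ δ)    p s B B′ =
  All (λ s′ → + 3 ∣ liftDifference p s B ℤ.- liftDifference p s′ B′ → δ ≡ 0 × B ≡ B′) (reachable δ s)
Separated -[1+ _ ] p s B B′ = ⊤

separated? : ∀ d p s B B′ → Dec (Separated d p s B B′)
separated? (+ δ)    p s B B′ = All.all?
  (λ s′ → (+ 3 ∣? liftDifference p s B ℤ.- liftDifference p s′ B′) →-dec ((δ ℕ.≟ 0) ×-dec (B ≟ B′)))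
  (reachable δ s)
separated? -[1+ _ ] p s B B′ = yes tt

-- The whole finite verification. It looks at most four letters ahead and does not mention m, so it
-- serves every word length at once.
letters-separated : ∀ p s B B′ → Separated (displacement p B ℤ.- displacement p B′) p s B B′
letters-separated = from-yes (all? λ p → all? λ s → all? λ B → all? λ B′ →
  separated? (displacement p B ℤ.- displacement p B′) p s B B′)

next : Fin (suc m) → Fin (suc m)
next t with view t
... | ‵fromℕ     = zero
... | ‵inject₁ i = suc i

next^ : ℕ → Fin (suc m) → Fin (suc m)
next^ 0       t = t
next^ (suc δ) t = next^ δ (next t)

next-+1 : (t : Fin (suc m)) → + suc m ∣ (+ toℕ t ℤ.+ + 1) ℤ.- + toℕ (next t)
next-+1 {m} t with view t
... | ‵fromℕ     = divides (+ 1) (trans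
  (cong (λ k → (+ k ℤ.+ + 1) ℤ.- 0ℤ) (toℕ-fromℕ m)) (wrap (+ m)))
  where
  wrap : ∀ k → (k ℤ.+ + 1) ℤ.- 0ℤ ≡ + 1 ℤ.* (+ 1 ℤ.+ k)
  wrap = solve-∀
... | ‵inject₁ i = divides 0ℤ (trans
  (cong (λ k → (+ k ℤ.+ + 1) ℤ.- + suc (toℕ i)) (toℕ-inject₁ i)) (shift (+ toℕ i) (+ suc m)))
  where
  shift : ∀ k n → (k ℤ.+ + 1) ℤ.- (+ 1 ℤ.+ k) ≡ 0ℤ ℤ.* n
  shift = solve-∀

next^-+ : ∀ δ (t : Fin (suc m)) → + suc m ∣ (+ toℕ t ℤ.+ + δ) ℤ.- + toℕ (next^ δ t)
next^-+ {m} 0 t = divides 0ℤ (stay (+ toℕ t) (+ suc m))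
  where
  stay : ∀ t n → (t ℤ.+ 0ℤ) ℤ.- t ≡ 0ℤ ℤ.* n
  stay = solve-∀
next^-+ (suc δ) t = subst (_ ∣_)
  (telescope (+ toℕ t) (+ toℕ (next t)) (+ δ) (+ toℕ (next^ δ (next t))))
  (∣m∣n⇒∣m+n (next-+1 t) (next^-+ δ (next t)))
  where
  telescope : ∀ t t′ δ t″ → ((t ℤ.+ + 1) ℤ.- t′) ℤ.+ ((t′ ℤ.+ δ) ℤ.- t″) ≡ (t ℤ.+ (+ 1 ℤ.+ δ)) ℤ.- t″
  telescope = solve-∀

-- The cyclic word is w 0, ..., w m, and `closing` is the step across its end. Defining w on all of
-- ℕ keeps `step` free of bounds.
module ClosedWalk (w : ℕ → Letter) (m : ℕ) (step : ∀ i → w (suc i) ∈ followers (w i))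
                  (closing : w 0 ∈ followers (w m)) where

  letter : Fin (suc m) → Letter
  letter t = w (toℕ t)

  next-follows : ∀ t → letter (next t) ∈ followers (letter t)
  next-follows t with view t
  ... | ‵fromℕ     = subst (λ k → w 0 ∈ followers (w k)) (sym (toℕ-fromℕ m)) closing
  ... | ‵inject₁ i = subst (λ k → w (suc (toℕ i)) ∈ followers (w k)) (sym (toℕ-inject₁ i)) (step (toℕ i))

  next^-reachable : ∀ δ t → letter (next^ δ t) ∈ reachable δ (letter t)
  next^-reachable 0       t = here refl
  next^-reachable (suc δ) t = ∈-concatMap⁺ (reachable δ)
    (Any.map (λ { refl → next^-reachable δ (next t) }) (next-follows t))

  -- Equality of the p-th differences of two columns, after `factor p` has been cancelled from the
  -- cyclic component.
  Clash : Fin 6 → (t t′ : Fin (suc m)) (B B′ : Fin 3) → Set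
  Clash p t t′ B B′ =
    + suc m ∣ (+ toℕ t ℤ.+ displacement p B) ℤ.- (+ toℕ t′ ℤ.+ displacement p B′) ×
    + 3 ∣ liftDifference p (letter t) B ℤ.- liftDifference p (letter t′) B′

  -- The first congruence puts t′ exactly δ steps after t on the cyclic word, so its letter is
  -- covered by the finite check. The check also yields δ = 0, which turns `next^ δ t` into t.
  no-clash-forward : ∀ p t t′ B B′ δ → displacement p B ℤ.- displacement p B′ ≡ + δ →
                     Clash p t t′ B B′ → t ≡ t′ × B ≡ B′
  no-clash-forward p t t′ B B′ δ d≡δ (m∣ , 3∣) =
    trans (cong (λ ε → next^ ε t) (sym δ≡0)) next^t≡t′ , B≡B′
    where
    difference : ∀ t d d′ t′ t″ → ((t ℤ.+ (d ℤ.- d′)) ℤ.- t″) ℤ.- ((t ℤ.+ d) ℤ.- (t′ ℤ.+ d′)) ≡ t′ ℤ.- t″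
    difference = solve-∀

    next^t≡t′ : next^ δ t ≡ t′
    next^t≡t′ = sym (toℕ-injective (residue-injective (toℕ<n t′) (toℕ<n (next^ δ t)) (subst (_ ∣_)
      (difference (+ toℕ t) (displacement p B) (displacement p B′) (+ toℕ t′) (+ toℕ (next^ δ t)))
      (∣m∣n⇒∣m-n (subst (λ d → _ ∣ (+ toℕ t ℤ.+ d) ℤ.- _) (sym d≡δ) (next^-+ δ t)) m∣))))

    apart : δ ≡ 0 × B ≡ B′
    apart = All.lookup
      (subst (λ d → Separated d p (letter t) B B′) d≡δ (letters-separated p (letter t) B B′))
      (subst (λ u → letter u ∈ reachable δ (letter t)) next^t≡t′ (next^-reachable δ t)) 3∣

    δ≡0 : δ ≡ 0
    δ≡0 = proj₁ apart

    B≡B′ : B ≡ B′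
    B≡B′ = proj₂ apart

  no-clash : ∀ p t t′ B B′ → Clash p t t′ B B′ → t ≡ t′ × B ≡ B′
  no-clash p t t′ B B′ (m∣ , 3∣) with displacement p B ℤ.- displacement p B′ in d≡
  ... | + δ      = no-clash-forward p t t′ B B′ δ d≡ (m∣ , 3∣)
  ... | -[1+ δ ] =
    let t′≡t , B′≡B = no-clash-forward p t′ t B′ B (suc δ)
          (trans (sym (neg-sub (displacement p B) (displacement p B′))) (cong ℤ.-_ d≡))
          (flip (+ toℕ t ℤ.+ displacement p B) (+ toℕ t′ ℤ.+ displacement p B′) m∣ ,
           flip (liftDifference p (letter t) B) (liftDifference p (letter t′) B′) 3∣)
    in sym t′≡t , sym B′≡B
    where
    neg-sub : ∀ a b → ℤ.- (a ℤ.- b) ≡ b ℤ.- a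
    neg-sub = solve-∀

    flip : ∀ a b {k} → k ∣ a ℤ.- b → k ∣ b ℤ.- a
    flip a b k∣ = subst (_ ∣_) (neg-sub a b) (∣m⇒∣-m k∣)

  -- The shift is 2B so that 2t + 2B = 2 (t + B): every displacement is then a small integer, with
  -- no halving modulo `suc m`.
  module Rows = LiftedRows (cyclic (suc m)) (λ a → a ℤ.+ a) (λ B → + toℕ B ℤ.+ + toℕ B) (lifts ∘ letter)

  difference-form : ∀ p t B → Rows.difference p t B ≡
    (+ factor p ℤ.* (+ toℕ t ℤ.+ displacement p B) , liftDifference p (letter t) B)
  difference-form 0F t B = cong₂ _,_ (form (+ toℕ t)) refl
    where form : ∀ t → t ≡ + 1 ℤ.* (t ℤ.+ 0ℤ)
          form = solve-∀
  difference-form 1F t B = cong₂ _,_ (form (+ toℕ t) (+ toℕ B)) refl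
    where form : ∀ t b → (t ℤ.+ t) ℤ.+ (b ℤ.+ b) ≡ + 2 ℤ.* (t ℤ.+ b)
          form = solve-∀
  difference-form 2F t B = cong₂ _,_ (form (+ toℕ t)) refl
    where form : ∀ t → t ℤ.+ (t ℤ.+ t) ≡ + 3 ℤ.* (t ℤ.+ 0ℤ)
          form = solve-∀
  difference-form 3F t B = cong₂ _,_ (form (+ toℕ t) (+ toℕ B)) refl
    where form : ∀ t b → ((t ℤ.+ t) ℤ.+ (b ℤ.+ b)) ℤ.- t ≡ + 1 ℤ.* (t ℤ.+ (b ℤ.+ b))
          form = solve-∀
  difference-form 4F t B = cong₂ _,_ (form (+ toℕ t)) refl
    where form : ∀ t → (t ℤ.+ (t ℤ.+ t)) ℤ.- t ≡ + 2 ℤ.* (t ℤ.+ 0ℤ)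
          form = solve-∀
  difference-form 5F t B = cong₂ _,_ (form (+ toℕ t) (+ toℕ B)) refl
    where form : ∀ t b → (t ℤ.+ (t ℤ.+ t)) ℤ.- ((t ℤ.+ t) ℤ.+ (b ℤ.+ b)) ≡ + 1 ℤ.* (t ℤ.- (b ℤ.+ b))
          form = solve-∀

  -- The factors 1, 2 and 3 are units modulo `suc m`, so equal differences produce a `Clash`.
  order-3m : Coprime (suc m) 2 → Coprime (suc m) 3 → DifferenceMatrix (suc m * 3)
  order-3m m⊥2 m⊥3 = Rows.lifted separating
    where
    coprime-factor : ∀ p → Coprime (suc m) (factor p)
    coprime-factor 0F = coprime-sym (1-coprimeTo (suc m))
    coprime-factor 1F = m⊥2
    coprime-factor 2F = m⊥3
    coprime-factor 3F = coprime-sym (1-coprimeTo (suc m))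
    coprime-factor 4F = m⊥2
    coprime-factor 5F = coprime-sym (1-coprimeTo (suc m))

    open FiniteAbelianGroup (cyclic (suc m) ⊗ cyclic 3) using (_≈_)

    separating : ∀ p → Rows.Separating p
    separating p i j eq =
      let t , B = remQuot {suc m} 3 i
          t′ , B′ = remQuot {suc m} 3 j
          m∣ , 3∣ = subst₂ _≈_ (difference-form p t B) (difference-form p t′ B′) eq
          t≡t′ , B≡B′ = no-clash p t t′ B B′
            (cancel-coprime (factor p) _ _ (coprime-factor p) m∣ , 3∣)
      in remQuot-injective (cong₂ _,_ t≡t′ B≡B′)

-- The last two go once round q or r and then round p forever. Cut after 4 + 3a or 5 + 3a letters,
-- they stop at the end of a loop and can be closed.
walk-p walk-qp walk-rp : ℕ → Letter
walk-p 0                   = p₀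
walk-p 1                   = p₁
walk-p 2                   = p₂
walk-p (suc (suc (suc i))) = walk-p i

walk-qp 0                         = q₀
walk-qp 1                         = q₁
walk-qp 2                         = q₂
walk-qp 3                         = q₃
walk-qp (suc (suc (suc (suc i)))) = walk-p i

walk-rp 0                               = r₀
walk-rp 1                               = r₁
walk-rp 2                               = r₂
walk-rp 3                               = r₃
walk-rp 4                               = r₄
walk-rp (suc (suc (suc (suc (suc i))))) = walk-p i

walk-p-step : ∀ i → walk-p (suc i) ∈ followers (walk-p i)
walk-p-step 0                   = here refl
walk-p-step 1                   = here refl
walk-p-step 2                   = here refl
walk-p-step (suc (suc (suc i))) = walk-p-step i

walk-p-end : ∀ a → walk-p (2 + a * 3) ≡ p₂
walk-p-end 0       = refl
walk-p-end (suc a) = walk-p-end a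

order-3[4+3a] : ∀ a → Coprime (4 + a * 3) 2 → Coprime (4 + a * 3) 3 →
                DifferenceMatrix ((4 + a * 3) * 3)
order-3[4+3a] a = ClosedWalk.order-3m walk-qp (3 + a * 3) step (closing a)
  where
  step : ∀ i → walk-qp (suc i) ∈ followers (walk-qp i)
  step 0                         = here refl
  step 1                         = here refl
  step 2                         = here refl
  step 3                         = here refl
  step (suc (suc (suc (suc i)))) = walk-p-step i

  closing : ∀ a → q₀ ∈ followers (walk-qp (3 + a * 3))
  -- The last letter is q₃ for a = 0 and p₂ otherwise; q₀ is the second follower of both.
  closing 0       = there (here refl)
  closing (suc a) rewrite walk-p-end a = there (here refl)

order-3[5+3a] : ∀ a → Coprime (5 + a * 3) 2 → Coprime (5 + a * 3) 3 →
                DifferenceMatrix ((5 + a * 3) * 3)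
order-3[5+3a] a = ClosedWalk.order-3m walk-rp (4 + a * 3) step (closing a)
  where
  step : ∀ i → walk-rp (suc i) ∈ followers (walk-rp i)
  step 0                               = here refl
  step 1                               = here refl
  step 2                               = here refl
  step 3                               = here refl
  step 4                               = here refl
  step (suc (suc (suc (suc (suc i))))) = walk-p-step i

  closing : ∀ a → r₀ ∈ followers (walk-rp (4 + a * 3))
  closing 0       = there (there (here refl))
  closing (suc a) rewrite walk-p-end a = there (there (here refl))

-- Factorisation of v and assembly of the pieces.

prime[3] : Prime 3
prime[3] = from-yes (prime? 3)

∤⇒coprime : ∀ {p} → Prime p → p ℕ.∤ m → Coprime m p
∤⇒coprime p-prime p∤m (d∣m , d∣p) with prime⇒irreducible p-prime d∣p
... | inj₁ d≡1  = d≡1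
... | inj₂ refl = contradiction d∣m p∤m

extract-power : ∀ p → .{{NonTrivial p}} → ∀ n → .{{NonZero n}} → ∃₂ λ k m → n ≡ p ^ k * m × p ℕ.∤ m
extract-power p n = <-rec (λ n → .{{NonZero n}} → ∃₂ λ k m → n ≡ p ^ k * m × p ℕ.∤ m) extract n
  where
  extract : ∀ n → (∀ {q} → q < n → .{{NonZero q}} → ∃₂ λ k m → q ≡ p ^ k * m × p ℕ.∤ m) →
            .{{NonZero n}} → ∃₂ λ k m → n ≡ p ^ k * m × p ℕ.∤ m
  extract n rec with p ℕ.∣? n
  ... | no p∤n = 0 , n , sym (ℕ.*-identityˡ n) , p∤n
  ... | yes (ℕ.divides q@(suc _) refl) =
    let k , m , q≡pᵏm , p∤m = rec (ℕ.m<m*n q p (nonTrivial⇒n>1 p))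
    in suc k , m , trans (ℕ.*-comm q p) (trans (cong (p *_) q≡pᵏm) (sym (ℕ.*-assoc p (p ^ k) m))) , p∤m

order-1 : DifferenceMatrix 1
order-1 = coprimeToSix (1-coprimeTo 2) (1-coprimeTo 3)

module _ (p c : ℕ) (p² : DifferenceMatrix (p * p)) where

  -- A factor p² raises the exponent by two, so exponents 2 and 3 start the induction. With c = 1
  -- this gives pure powers; with p = 2 and c = 3 it starts from orders 12 and 24.
  multiple-of-power : DifferenceMatrix (p ^ 2 * c) → DifferenceMatrix (p ^ 3 * c) →
                      ∀ k → DifferenceMatrix (p ^ (2 + k) * c)
  multiple-of-power p²c p³c 0             = p²c
  multiple-of-power p²c p³c 1             = p³c
  multiple-of-power p²c p³c (suc (suc k)) =
    subst DifferenceMatrix (regroup p (p ^ (2 + k)) c) (p² ⊠ multiple-of-power p²c p³c k)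
    where
    regroup : ∀ p q c → p * p * (q * c) ≡ p * (p * q) * c
    regroup = ℕ-RingSolver.solve-∀

power : ∀ p → .{{NonZero p}} → ∀ k → k ≢ 1 → DifferenceMatrix (p ^ k)
power p 0             k≢1 = order-1
power p 1             k≢1 = contradiction refl k≢1
power p (suc (suc k)) k≢1 = subst DifferenceMatrix (ℕ.*-identityʳ _)
  (multiple-of-power p 1 (square (cyclic p))
    (subst DifferenceMatrix (p²≡ p) (square (cyclic p)))
    (subst DifferenceMatrix (p³≡ p) (cube (cyclic p))) k)
  where
  p²≡ : ∀ p → p * p ≡ p * (p * 1) * 1
  p²≡ = ℕ-RingSolver.solve-∀
  p³≡ : ∀ p → p * (p * p) ≡ p * (p * (p * 1)) * 1
  p³≡ = ℕ-RingSolver.solve-∀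

-- The residue of m modulo 3 chooses between the loops q and r. The values 1 and 2, too short for
-- either, are excluded by `m≢1` and by oddness.
three-times : ∀ m → m ≢ 1 → 2 ℕ.∤ m → 3 ℕ.∤ m → DifferenceMatrix (m * 3)
three-times m m≢1 2∤m 3∤m with m divMod 3
... | result q       0F refl = contradiction (ℕ.divides q refl) 3∤m
... | result 0       1F refl = contradiction refl m≢1
... | result (suc a) 1F refl = order-3[4+3a] a (∤⇒coprime prime[2] 2∤m) (∤⇒coprime prime[3] 3∤m)
... | result 0       2F refl = contradiction ℕ.∣-refl 2∤m
... | result (suc a) 2F refl = order-3[5+3a] a (∤⇒coprime prime[2] 2∤m) (∤⇒coprime prime[3] 3∤m)

2*odd%4≡2 : ∀ u → 2 ℕ.∤ u → 2 ^ 1 * u % 4 ≡ 2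
2*odd%4≡2 u 2∤u = trans (cong (_% 4) (ℕ.*-comm 2 u)) (trans (sym (m%n*o≡m*o%[n*o] u 2 2)) (cong (_* 2) u%2≡1))
  where
  u%2≡1 : u % 2 ≡ 1
  u%2≡1 with u % 2 in eq | m%n<n u 2
  ... | 0 | _ = contradiction (ℕ.m%n≡0⇒n∣m u 2 eq) 2∤u
  ... | 1 | _ = refl
  ... | suc (suc _) | s≤s (s≤s ())

-- Unless b = 1, the three factors are handled separately. A single 3 is joined to m when a = 0 and
-- to the power of 2 when a is at least 2.
assemble : ∀ a b m → a ≢ 1 → 2 ℕ.∤ m → 3 ℕ.∤ m → 4 ≤ 2 ^ a * (3 ^ b * m) →
           DifferenceMatrix (2 ^ a * (3 ^ b * m))
assemble a b m a≢1 2∤m 3∤m v≥4 = go a b a≢1 v≥4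
  where
  instance
    m≢0 : NonZero m
    m≢0 = ≢-nonZero λ { refl → 3∤m (3 ℕ.∣0) }

  m-matrix : DifferenceMatrix m
  m-matrix = coprimeToSix (∤⇒coprime prime[2] 2∤m) (∤⇒coprime prime[3] 3∤m)

  -- The bound on v excludes v = 3.
  m≢1 : 4 ≤ 1 * (3 * m) → m ≢ 1
  m≢1 (s≤s (s≤s (s≤s ()))) refl

  regroup : ∀ m → m * 3 ≡ 1 * (3 * m)
  regroup = ℕ-RingSolver.solve-∀

  go : ∀ a b → a ≢ 1 → 4 ≤ 2 ^ a * (3 ^ b * m) → DifferenceMatrix (2 ^ a * (3 ^ b * m))
  go a b a≢1 v≥4 with b ℕ.≟ 1
  go a               b a≢1 v≥4 | no b≢1   = power 2 a a≢1 ⊠ (power 3 b b≢1 ⊠ m-matrix)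
  go 0               b a≢1 v≥4 | yes refl =
    subst DifferenceMatrix (regroup m) (three-times m (m≢1 v≥4) 2∤m 3∤m)
  go 1               b a≢1 v≥4 | yes refl = contradiction refl a≢1
  go a@(suc (suc k)) b a≢1 v≥4 | yes refl =
    subst DifferenceMatrix (ℕ.*-assoc (2 ^ a) 3 m)
      (multiple-of-power 2 3 (square (cyclic 2)) order-12 order-24 k ⊠ m-matrix)

differenceMatrix : ∀ v → 4 ≤ v → v % 4 ≢ 2 → DifferenceMatrix v
differenceMatrix v v≥4 v%4≢2 with extract-power 2 v {{>-nonZero (ℕ.≤-trans (s≤s z≤n) v≥4)}}
... | a , u , refl , 2∤u with extract-power 3 u {{≢-nonZero λ { refl → 2∤u (2 ℕ.∣0) }}}
... | b , m , refl , 3∤m = assemble a b m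
  (λ { refl → v%4≢2 (2*odd%4≡2 (3 ^ b * m) 2∤u) }) (2∤u ∘ ℕ.∣n⇒∣m*n (3 ^ b)) 3∤m v≥4

theorem2p11 : (v : ℕ) → 4 ≤ v → v % 4 ≢ 2 → AOA 1 3 5 v
theorem2p11 v v≥4 v%4≢2 = FromDifferenceMatrix.aoa (differenceMatrix v v≥4 v%4≢2)
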